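{- For all integers $m\ge 2$ and $n\ge 3$, \[\textup{aw}(P_m\square C_n,3)=\begin{cases}4 & \text{if $n$ is even and $\textup{diam}(P_m\square C_n)$ is odd,}\\ 3 & \text{otherwise.}\end{cases}\]
   Context: All graphs are finite, simple and undirected; $\textup{d}(u,v)$ denotes shortest-path distance and $\textup{diam}$ the diameter. $P_m$ is the path on $m$ vertices and $C_n$ the cycle on $n$ vertices. The Cartesian product $G\square H$ has vertex set $V(G)\times V(H)$, with $(x,y)$ adjacent to $(x',y')$ iff either $x=x'$ and $yy'\in E(H)$, or $y=y'$ and $xx'\in E(G)$. A 3-term arithmetic progression (3-AP) in a graph $G$ is a set of vertices $\{v_1,v_2,v_3\}$ (listed in some order) with $\textup{d}(v_1,v_2)=\textup{d}(v_2,v_3)$. An exact $r$-coloring of $G$ is a surjective map $c:V(G)\to\{1,\dots,r\}$; a set of vertices is rainbow under $c$ if its vertices receive pairwise distinct colors. The anti-van der Waerden number $\textup{aw}(G,3)$ is the least positive integer $r$ such that every exact $r$-coloring of $G$ contains a rainbow 3-AP; if no coloring of $V(G)$ yields a rainbow 3-AP, then $\textup{aw}(G,3)=|V(G)|+1$. -}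

module Defs where

open import Data.Nat using (ℕ; zero; suc; _+_; _<_; _≤_; _%_)
open import Data.Fin using (Fin; toℕ)
open import Data.Product using (Σ; ∃; _×_; _,_)
open import Data.Sum using (_⊎_)
open import Relation.Nullary using (¬_)
open import Relation.Binary.PropositionalEquality using (_≡_; _≢_)

-- A graph is given by a vertex type and a (symmetric, irreflexive) adjacency relation.
record Graph : Set₁ where
  field
    V   : Set
    Adj : V → V → Set
open Graph public

data Walk (G : Graph) : V G → V G → ℕ → Set where
  here : ∀ {u} → Walk G u u zero
  step : ∀ {u v w k} → Adj G u v → Walk G v w k → Walk G u w (suc k)

Dist : (G : Graph) → V G → V G → ℕ → Set
Dist G u v k = Walk G u v k × (∀ j → j < k → ¬ Walk G u v j)

IsDiam : (G : Graph) → ℕ → Set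
IsDiam G D = (∃ λ u → ∃ λ v → Dist G u v D)
           × (∀ u v → ∃ λ k → Dist G u v k × k ≤ D)

PathAdj : (m : ℕ) → Fin m → Fin m → Set
PathAdj m i j = (suc (toℕ i) ≡ toℕ j) ⊎ (suc (toℕ j) ≡ toℕ i)

-- Cycle C_n on vertices 0..n-1 (i ~ i+1 mod n); n ≥ 3 assumed where used.
CycleAdj : (n : ℕ) → Fin n → Fin n → Set
CycleAdj zero () _
CycleAdj (suc n) i j = ((suc (toℕ i)) % (suc n) ≡ toℕ j) ⊎ ((suc (toℕ j)) % (suc n) ≡ toℕ i)

_□_ : Graph → Graph → Graph
G □ H = record
  { V   = V G × V H
  ; Adj = λ { (x , y) (x' , y') → (x ≡ x' × Adj H y y') ⊎ (y ≡ y' × Adj G x x') }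
  }

P : ℕ → Graph
P m = record { V = Fin m ; Adj = PathAdj m }

C : ℕ → Graph
C n = record { V = Fin n ; Adj = CycleAdj n }

Surj : {A B : Set} → (A → B) → Set
Surj {A} {B} c = ∀ (b : B) → ∃ λ (a : A) → c a ≡ b

-- c admits a rainbow 3-AP: vertices v1,v2,v3 with d(v1,v2)=d(v2,v3)
-- and pairwise distinct colours (hence pairwise distinct vertices).
HasRainbow3AP : (G : Graph) {r : ℕ} → (V G → Fin r) → Set
HasRainbow3AP G c = ∃ λ v₁ → ∃ λ v₂ → ∃ λ v₃ → ∃ λ k →
  Dist G v₁ v₂ k × Dist G v₂ v₃ k ×
  c v₁ ≢ c v₂ × c v₂ ≢ c v₃ × c v₁ ≢ c v₃

AWProp : Graph → ℕ → Set
AWProp G r = (c : V G → Fin r) → Surj c → HasRainbow3AP G c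

-- aw(G,3) = r : r is the least positive integer with AWProp G r.
-- (If no colouring yields a rainbow 3-AP, the least such r is |V(G)|+1,
--  since no surjection V(G) → Fin (|V(G)|+1) exists; so this matches.)
AW3≡ : Graph → ℕ → Set
AW3≡ G r = 1 ≤ r × AWProp G r × (∀ s → 1 ≤ s → s < r → ¬ AWProp G s)

{-# OPTIONS --safe #-}

-- Suppose a colouring c is rainbow-free and uses at least three colours. Some edge bt is
-- bichromatic and some vertex w has a third colour; choose these with k = d(t,w) minimal.
-- Then d(b,w) = k + 1, all interior vertices of geodesics from b to w have the colour ρ of t,
-- k + 1 is odd (otherwise a midpoint gives a rainbow 3-AP), and b may be replaced by any b′
-- with d(b′,w) = k + 1 that has a common neighbour with b at distance k from w. Playing these
-- moves and a reflection of the cycle against minimality forces b and w to be antipodal in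
-- both factors. For odd n the two antipodes of a cycle vertex give a contradiction; for even
-- n, d(b,v) + d(v,w) = k + 1 for every v, which leaves no room for a fourth colour.
-- Conversely, if n is even and the diameter is odd, giving two antipodal vertices private
-- colours and all others a third colour avoids rainbow 3-APs.

module Submission where

open import Defs
open import Algebra.Properties.CommutativeSemigroup using (interchange)
open import Data.Bool using (if_then_else_)
open import Data.Empty using (⊥; ⊥-elim)
open import Data.Fin as F using (Fin; toℕ; fromℕ; fromℕ<)
open import Data.Fin.Properties using (toℕ-injective; toℕ-fromℕ; toℕ-fromℕ<; toℕ<n; all?; any?)
open import Data.Nat
open import Data.Nat.Divisibility using (_∣_; _∣?_; divides)
open import Data.Nat.DivMod
open import Data.Nat.Induction using (<-rec)
open import Data.Nat.Properties
open import Data.Product using (∃; _×_; _,_; proj₁; proj₂)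
open import Data.Product.Properties using (≡-dec)
open import Data.Sum using (_⊎_; inj₁; inj₂; [_,_]′; swap)
open import Relation.Binary.Definitions using (DecidableEquality)
open import Relation.Binary.PropositionalEquality
open import Relation.Nullary using (Dec; yes; no; does; ¬_; ¬?)
open import Relation.Nullary.Decidable using (_×-dec_; map′; dec-true; dec-false; decidable-stable; from-yes)

-- Rainbow-free colourings of geodesic metrics

-- The colouring argument runs on these four properties alone, without walks. `d-split` supplies the
-- vertices of a geodesic.
record IsGeodesicMetric {V : Set} (d : V → V → ℕ) : Set where
  field
    d-zero  : ∀ {u v} → d u v ≡ 0 → u ≡ v
    d-sym   : ∀ u v → d u v ≡ d v u
    d-tri   : ∀ u v w → d u w ≤ d u v + d v w
    d-split : ∀ i j {u v} → d u v ≡ i + j → ∃ λ z → d u z ≡ i × d z v ≡ j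

  d-exactʳ : ∀ {i j u z v} → d u v ≡ i + j → d u z ≡ i → d z v ≤ j → d z v ≡ j
  d-exactʳ {i} {j} {u} {z} {v} uv uz zv = ≤-antisym zv (+-cancelˡ-≤ i j (d z v)
    (subst₂ _≤_ uv (cong (_+ d z v) uz) (d-tri u z v)))

  -- The detour through `z` bounds `d y v` from above; anything shorter would undercut `d u v`. So
  -- `y` and `z` lie in this order on a geodesic.
  d-between : ∀ {i j l u y z v} → d u v ≡ i + (j + l) →
              d u y ≡ i → d y z ≡ j → d z v ≡ l → d y v ≡ j + l
  d-between {i} {j} {l} {u} {y} {z} {v} uv uy yz zv = d-exactʳ uv uy
    (subst (d y v ≤_) (cong₂ _+_ yz zv) (d-tri y z v))

  d-trim : ∀ j {u v} → d u v ≡ suc (suc j) → ∃ λ u′ → ∃ λ v′ →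
           d u u′ ≡ 1 × d u′ v ≡ suc j × d v v′ ≡ 1 × d v′ u ≡ suc j × d u′ v′ ≡ j
  d-trim j {u} {v} uv with d-split 1 (suc j) uv
  ... | u′ , uu′ , u′v with d-split j 1 (trans u′v (+-comm 1 j))
  ... | v′ , u′v′ , v′v = u′ , v′ , uu′ , u′v , vv′ ,
      trans (d-between (trans (d-sym v u) (trans uv (cong suc (+-comm 1 j)))) vv′
        (trans (d-sym v′ u′) u′v′) (trans (d-sym u′ u) uu′)) (+-comm j 1) , u′v′
    where
    vv′ : d v v′ ≡ 1
    vv′ = trans (d-sym v v′) v′v

module Colouring {V : Set} (d : V → V → ℕ) {r : ℕ} (c : V → Fin r) where

  RainbowFree : Set
  RainbowFree = ∀ u v w → d u v ≡ d v w → c u ≢ c v → c v ≢ c w → c u ≢ c w → ⊥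

  -- `d b w` is not a field: for minimal `k` it is derived in `ends`. The colour `ρ` is a parameter
  -- because sliding replaces `t` but keeps its colour.
  record Separated (k : ℕ) (ρ : Fin r) (b w : V) : Set where
    field
      t   : V
      bt  : d b t ≡ 1
      tw  : d t w ≡ k
      ct  : c t ≡ ρ
      b≢ρ : c b ≢ ρ
      w≢ρ : c w ≢ ρ
      b≢w : c b ≢ c w

  NoneBelow : ℕ → Set
  NoneBelow k = ∀ {j} → j < k → ∀ {ρ b w} → ¬ Separated j ρ b w

  no-minimal⇒none : (∀ k → NoneBelow k → ∀ {ρ b w} → ¬ Separated k ρ b w) → ∀ k {ρ b w} → ¬ Separated k ρ b w
  no-minimal⇒none none = <-rec (λ k → ∀ {ρ b w} → ¬ Separated k ρ b w) λ k rec → none k λ lt → rec lt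

  module _ (metric : IsGeodesicMetric d) where
    open IsGeodesicMetric metric

    bichromatic-edge : ∀ i {u v} → d u v ≡ i → c u ≢ c v → ∃ λ b → ∃ λ t → d b t ≡ 1 × c b ≢ c t
    bichromatic-edge zero    uv u≢v = ⊥-elim (u≢v (cong c (d-zero uv)))
    bichromatic-edge (suc i) {u} {v} uv u≢v with d-split 1 i uv
    ... | z , uz , zv with c u F.≟ c z
    ... | no u≢z  = u , z , uz , u≢z
    ... | yes u≡z = bichromatic-edge i zv (λ e → u≢v (trans u≡z e))

  -- Local structure of a minimal configuration.

  module Minimal (metric : IsGeodesicMetric d) (free : RainbowFree) (k : ℕ) (none-below : NoneBelow k) where
    open IsGeodesicMetric metric

    -- Decidable equality of colours turns rainbow-freeness into this positive form, which most
    -- later steps use.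
    isosceles : ∀ {u} v {w} → d u v ≡ d v w → c u ≢ c v → c w ≡ c u ⊎ c w ≡ c v
    isosceles {u} v {w} eq u≢v with c w F.≟ c u | c w F.≟ c v
    ... | yes p | _ = inj₁ p
    ... | no _ | yes p = inj₂ p
    ... | no p | no q = ⊥-elim (free u v w eq u≢v (λ e → q (sym e)) (λ e → p (sym e)))

    far : ∀ {b t w} → d b t ≡ 1 → c b ≢ c t → c w ≢ c b → c w ≢ c t → k ≤ d t w
    far {b} {t} {w} bt b≢t w≢b w≢t = ≮⇒≥ λ lt → none-below lt record
      { t = t ; bt = bt ; tw = refl ; ct = refl ; b≢ρ = b≢t ; w≢ρ = w≢t ; b≢w = λ e → w≢b (sym e) }

    module _ {ρ : Fin r} {b w : V} (S : Separated k ρ b w) where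
      open Separated S

      private
        t≢b : c t ≢ c b
        t≢b e = b≢ρ (trans (sym e) ct)

        t≢w : c t ≢ c w
        t≢w e = w≢ρ (trans (sym e) ct)

      -- Minimality for the reversed edge, from `t` to `b`.
      far-from-end : ∀ {v} → c v ≢ ρ → c v ≢ c b → k ≤ d b v
      far-from-end {v} v≢ρ v≢b =
        far (trans (d-sym t b) bt) t≢b (λ e → v≢ρ (trans e ct)) v≢b

      -- The route through `t` gives at most `k + 1`, and `far-from-end` at least `k`. Distance
      -- exactly `k` would make `t`, `w`, `b` a rainbow 3-AP with middle `w`.
      ends : d b w ≡ suc k
      ends = ≤-antisym (subst₂ (λ x y → d b w ≤ x + y) bt tw (d-tri b t w))
        (≤∧≢⇒< (far-from-end w≢ρ (λ e → b≢w (sym e)))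
          (λ e → free t w b (trans tw (trans e (d-sym b w))) t≢w (λ e → b≢w (sym e)) t≢b))

      -- `z` and `t` are equidistant from `b` and also from `w`. The first leaves `z` the colours of
      -- `t` and `b`, the second those of `t` and `w`.
      near : ∀ {z} → d b z ≡ 1 → d z w ≡ k → c z ≡ ρ
      near {z} bz zw with isosceles b (trans (trans (d-sym t b) bt) (sym bz)) t≢b
      ... | inj₁ e = trans e ct
      ... | inj₂ e with isosceles w (trans tw (trans (sym zw) (d-sym z w))) t≢w
      ... | inj₁ e′ = trans e′ ct
      ... | inj₂ e′ = ⊥-elim (b≢w (trans (sym e) e′))

      -- Induction along the geodesic from `b`: the vertex `y` just before `z` already has colour
      -- `ρ`.
      interior : ∀ i j {z} → d b z ≡ suc i → d z w ≡ suc j → suc i + suc j ≡ suc k → c z ≡ ρ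
      interior zero j bz zw eq = near bz (trans zw (suc-injective eq))
      interior (suc i) j {z} bz zw eq with d-split (suc i) 1 (trans bz (cong suc (+-comm 1 i)))
      ... | y , by , yz with interior i (suc j) by
               (d-between (trans ends (trans (sym eq) (cong suc (sym (+-suc i (suc j)))))) by yz zw)
               (trans (cong suc (+-suc i (suc j))) eq)
      ... | cy with c z F.≟ ρ | c z F.≟ c w
      ... | yes p | _ = p
      -- The edge from `y` to `z` is bichromatic and `w` has a third colour, at distance less than
      -- `k` from `z`.
      ... | no z≢ρ | no z≢w = ⊥-elim (<⇒≱ j<k (subst (k ≤_) zw
              (far yz (λ e → z≢ρ (trans (sym e) cy)) (λ e → w≢ρ (trans e cy)) (λ e → z≢w (sym e)))))
        where
        j<k : suc j < k
        j<k = subst (suc j <_) (suc-injective eq) (s≤s (m≤n+m (suc j) i))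
      -- Now `z` itself takes the place of `w`: with the first edge `b s` of a geodesic to `z` it
      -- forms a configuration at distance less than `k`.
      ... | no z≢ρ | yes z≡w with d-split 1 (suc i) bz
      ... | s , bs , sz = ⊥-elim (<⇒≱ i<k (subst (k ≤_) sz
              (far bs (λ e → b≢ρ (trans e cs)) (λ e → b≢w (trans (sym e) z≡w)) (λ e → z≢ρ (trans e cs)))))
        where
        cs : c s ≡ ρ
        cs = near bs (trans (d-between (trans ends (sym eq)) bs sz zw) (suc-injective eq))
        i<k : suc i < k
        i<k = subst (suc i <_) (trans (sym (+-suc (suc i) j)) (suc-injective eq)) (s≤s (m≤m+n (suc i) j))

      k≢0 : k ≢ 0
      k≢0 e = t≢w (cong c (d-zero (trans tw e)))

      -- The last vertex before `w` on a geodesic from `b` has colour `ρ` by `interior`, so it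
      -- serves as `t` for `w`. Every fact about `b` thereby holds for `w` too.
      flip-ends : Separated k ρ w b
      flip-ends with d-split k 1 (trans ends (+-comm 1 k))
      ... | s , bs , sw = record
        { t = s ; bt = trans (d-sym w s) sw ; tw = trans (d-sym s b) bs
        ; ct = interior (pred k) 0 (trans bs (sym k⁺)) sw (trans (cong (_+ 1) k⁺) (+-comm k 1))
        ; b≢ρ = w≢ρ ; w≢ρ = b≢ρ ; b≢w = λ e → b≢w (sym e) }
        where
        k⁺ : suc (pred k) ≡ k
        k⁺ = suc-pred k {{≢-nonZero k≢0}}

      odd-length : ¬ (2 ∣ suc k)
      odd-length (divides zero ())
      odd-length (divides (suc q) eq) = no-middle (d-split (suc q) (suc q) (trans ends e))
        where
        e : suc k ≡ suc q + suc q
        e = trans eq (trans (*-comm (suc q) 2) (cong (suc q +_) (+-identityʳ (suc q))))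
        no-middle : ¬ (∃ λ z → d b z ≡ suc q × d z w ≡ suc q)
        no-middle (z , bz , zw) = free b z w (trans bz (sym zw))
          (λ x → b≢ρ (trans x cz)) (λ x → w≢ρ (trans (sym x) cz)) b≢w
          where
          cz : c z ≡ ρ
          cz = interior q q bz zw (sym e)

      2≤k : 2 ≤ k
      2≤k = ≤∧≢⇒< (n≢0⇒n>0 k≢0) (λ e → odd-length (divides 1 (cong suc (sym e))))

      -- `b` and `b′` are equidistant from `w` and also from `t′`, which has colour `ρ` by `near`.
      -- So `b′` could differ from `b` only by having both the colour of `w` and `ρ`.
      slide-colour : ∀ {t′ b′} → d b t′ ≡ 1 → d t′ w ≡ k → d b′ t′ ≡ 1 → d b′ w ≡ suc k → c b′ ≡ c b
      slide-colour {t′} {b′} bt′ tw′ bt″ bw′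
        with isosceles w (trans ends (trans (sym bw′) (d-sym b′ w))) b≢w
      ... | inj₁ e = e
      ... | inj₂ e with isosceles t′ (trans bt′ (trans (sym bt″) (d-sym b′ t′)))
                          (λ x → b≢ρ (trans x (near bt′ tw′)))
      ... | inj₁ e′ = e′
      ... | inj₂ e′ = ⊥-elim (w≢ρ (trans (sym e) (trans e′ (near bt′ tw′))))

      slide : ∀ {t′ b′} → d b t′ ≡ 1 → d t′ w ≡ k → d b′ t′ ≡ 1 → d b′ w ≡ suc k → Separated k ρ b′ w
      slide {t′} {b′} bt′ tw′ bt″ bw′ = record
        { t = t′ ; bt = bt″ ; tw = tw′ ; ct = near bt′ tw′
        ; b≢ρ = λ x → b≢ρ (trans (sym cb) x) ; w≢ρ = w≢ρ ; b≢w = λ x → b≢w (trans (sym cb) x) }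
        where
        cb : c b′ ≡ c b
        cb = slide-colour bt′ tw′ bt″ bw′

    module _ {ρ : Fin r} {b w : V} (S : Separated k ρ b w) where
      open Separated S

      -- Both ends keep their colours when slid, and `b′` is still an end of a minimal configuration
      -- with `w`. A vertex `w′` of a third colour must then be at distance at least `k` from `b′`.
      no-double-slide : ∀ {t′ b′ s′ w′} →
        d b t′ ≡ 1 → d t′ w ≡ k → d b′ t′ ≡ 1 → d b′ w ≡ suc k →
        d w s′ ≡ 1 → d s′ b ≡ k → d w′ s′ ≡ 1 → d w′ b ≡ suc k →
        d b′ w′ < k → ⊥
      no-double-slide e₁ e₂ e₃ e₄ f₁ f₂ f₃ f₄ lt = <⇒≱ lt
        (far-from-end (slide S e₁ e₂ e₃ e₄) (λ x → w≢ρ (trans (sym cw) x))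
          (λ x → b≢w (trans (sym (slide-colour S e₁ e₂ e₃ e₄)) (trans (sym x) cw))))
        where
        cw = slide-colour (flip-ends S) f₁ f₂ f₃ f₄

      -- v′ is a mirror image of w with d(b,v′) = d(b,w), so it has the colour of w or of b; in the
      -- first case it is too close to b′, in the second z is the middle of a rainbow 3-AP.
      no-reflection : ∀ {t′ b′ v′ z} i j →
        d b t′ ≡ 1 → d t′ w ≡ k → d b′ t′ ≡ 1 → d b′ w ≡ suc k →
        d b v′ ≡ suc k → d b′ v′ < k →
        d b z ≡ suc i → d z w ≡ suc j → suc i + suc j ≡ suc k → d z v′ ≡ suc j → ⊥
      no-reflection {v′ = v′} {z} i j e₁ e₂ e₃ e₄ bv lt bz zw eq zv
        with isosceles b (trans (d-sym w b) (trans (ends S) (sym bv))) (λ e → b≢w (sym e))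
      ... | inj₁ v≡w = <⇒≱ lt (far-from-end (slide S e₁ e₂ e₃ e₄) (λ x → w≢ρ (trans (sym v≡w) x))
               (λ x → b≢w (trans (sym (slide-colour S e₁ e₂ e₃ e₄)) (trans (sym x) v≡w))))
      ... | inj₂ v≡b = free w z v′ (trans (d-sym w z) (trans zw (sym zv)))
               (λ x → w≢ρ (trans x cz)) (λ x → b≢ρ (trans (sym v≡b) (trans (sym x) cz)))
               (λ x → b≢w (sym (trans x v≡b)))
        where
        cz = interior S i j bz zw eq

      -- Seen from `b`, the vertex `w′` has the colour of `w` or of `b`. In the first case `b`,
      -- `w′`, `b′` is rainbow with middle `w′`; in the second `w` is the middle between `w′` and
      -- its own neighbour of colour `ρ`.
      no-adjacent-antipodes : ∀ {b′ w′} →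
        d b w′ ≡ suc k → d w w′ ≡ 1 → d b b′ ≡ 1 → d b′ w ≡ k → d b′ w′ ≡ suc k → ⊥
      no-adjacent-antipodes {b′} {w′} bw′ ww′ bb′ b′w b′w′
        with isosceles b (trans (d-sym w b) (trans (ends S) (sym bw′))) (λ e → b≢w (sym e))
      ... | inj₁ w′≡w = free b w′ b′ (trans bw′ (trans (sym b′w′) (d-sym b′ w′)))
              (λ x → b≢w (trans x w′≡w)) (λ x → w≢ρ (trans (sym w′≡w) (trans x cb′)))
              (λ x → b≢ρ (trans x cb′))
        where
        cb′ = near S bb′ b′w
      ... | inj₂ w′≡b = free Flipped.t w w′ (trans (d-sym Flipped.t w) (trans Flipped.bt (sym ww′)))
              (λ x → Flipped.b≢ρ (trans (sym x) Flipped.ct)) (λ x → b≢w (sym (trans x w′≡b)))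
              (λ x → b≢ρ (trans (sym w′≡b) (trans (sym x) Flipped.ct)))
        where
        module Flipped = Separated (flip-ends S)

      -- Such a `v` is at distance at least `k` from both ends, so `2k ≤ k + 1`, against `2 ≤ k`.
      no-fourth-colour : ∀ {v} → d b v + d v w ≡ suc k → c v ≢ ρ → c v ≢ c b → c v ≢ c w → ⊥
      no-fourth-colour {v} eq v≢ρ v≢b v≢w = <⇒≱ (2≤k S) (+-cancelʳ-≤ k k 1
        (subst (k + k ≤_) eq (+-mono-≤ (far-from-end S v≢ρ v≢b)
          (subst (k ≤_) (d-sym w v) (far-from-end (flip-ends S) v≢ρ v≢w)))))

-- Distances in paths, cycles and products

_++ʷ_ : ∀ {G u v w i j} → Walk G u v i → Walk G v w j → Walk G u w (i + j)
here     ++ʷ q = q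
step a p ++ʷ q = step a (p ++ʷ q)

splitʷ : ∀ {G} i {j u v} → Walk G u v (i + j) → ∃ λ z → Walk G u z i × Walk G z v j
splitʷ zero    p          = _ , here , p
splitʷ (suc i) (step a p) = let z , q , q′ = splitʷ i p in z , step a q , q′

reverseʷ : ∀ {G} → (∀ {u v} → Adj G u v → Adj G v u) → ∀ {u v k} → Walk G u v k → Walk G v u k
reverseʷ adj-sym here = here
reverseʷ {G} adj-sym {v = v} (step {u = u} {k = k} a p) =
  subst (Walk G v u) (+-comm k 1) (reverseʷ adj-sym p ++ʷ step (adj-sym a) here)

-- d-lip bounds walks from below, d-walk from above.
record DistanceFunction (G : Graph) : Set where
  field
    adj-sym : ∀ {u v} → Adj G u v → Adj G v u
    d       : V G → V G → ℕ
    d-refl  : ∀ u → d u u ≡ 0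
    d-lip   : ∀ {u v} w → Adj G u v → d u w ≤ suc (d v w)
    d-walk  : ∀ u v → Walk G u v (d u v)

  walk⇒≤ : ∀ {u v k} → Walk G u v k → d u v ≤ k
  walk⇒≤ {u} here = ≤-reflexive (d-refl u)
  walk⇒≤ {v = v} (step a p) = ≤-trans (d-lip v a) (s≤s (walk⇒≤ p))

  dist : ∀ u v → Dist G u v (d u v)
  dist u v = d-walk u v , λ j j<d p → <⇒≱ j<d (walk⇒≤ p)

  dist-unique : ∀ {u v k} → Dist G u v k → k ≡ d u v
  dist-unique {u} {v} (p , min) = ≤-antisym (≮⇒≥ λ lt → min _ lt (d-walk u v)) (walk⇒≤ p)

  opaque
    isGeodesic : IsGeodesicMetric d
    isGeodesic = record { d-zero = d-zero ; d-sym = d-sym ; d-tri = d-tri ; d-split = d-split }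
      where
      d-tri : ∀ u v w → d u w ≤ d u v + d v w
      d-tri u v w = walk⇒≤ (d-walk u v ++ʷ d-walk v w)

      d-zero : ∀ {u v} → d u v ≡ 0 → u ≡ v
      d-zero {u} {v} eq with d u v | d-walk u v
      d-zero refl | _ | here = refl

      d-sym : ∀ u v → d u v ≡ d v u
      d-sym u v = ≤-antisym (walk⇒≤ (reverseʷ adj-sym (d-walk v u))) (walk⇒≤ (reverseʷ adj-sym (d-walk u v)))

      d-split : ∀ i j {u v} → d u v ≡ i + j → ∃ λ z → d u z ≡ i × d z v ≡ j
      d-split i j {u} {v} eq with splitʷ i (subst (Walk G u v) eq (d-walk u v))
      -- Neither half of the cut walk can be shortened, since the two distances must still add up to
      -- at least `i + j`.
      ... | z , p , q = z , ≤-antisym (walk⇒≤ p) i≤ , ≤-antisym (walk⇒≤ q) j≤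
        where
        i+j≤ : i + j ≤ d u z + d z v
        i+j≤ = subst (_≤ d u z + d z v) eq (d-tri u z v)
        i≤ : i ≤ d u z
        i≤ = +-cancelʳ-≤ j i (d u z) (≤-trans i+j≤ (+-monoʳ-≤ (d u z) (walk⇒≤ q)))
        j≤ : j ≤ d z v
        j≤ = +-cancelˡ-≤ i j (d z v) (≤-trans i+j≤ (+-monoˡ-≤ (d z v) (walk⇒≤ p)))

  open IsGeodesicMetric isGeodesic public

module _ {G H : Graph} where

  walk-□ˡ : ∀ {x x′ k} y → Walk G x x′ k → Walk (G □ H) (x , y) (x′ , y) k
  walk-□ˡ y here       = here
  walk-□ˡ y (step a p) = step (inj₂ (refl , a)) (walk-□ˡ y p)

  walk-□ʳ : ∀ {y y′ k} x → Walk H y y′ k → Walk (G □ H) (x , y) (x , y′) k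
  walk-□ʳ x here       = here
  walk-□ʳ x (step a p) = step (inj₁ (refl , a)) (walk-□ʳ x p)

  product-distance : DistanceFunction G → DistanceFunction H → DistanceFunction (G □ H)
  product-distance A B = record
    { adj-sym = λ { (inj₁ (e , a)) → inj₁ (sym e , B.adj-sym a) ; (inj₂ (e , a)) → inj₂ (sym e , A.adj-sym a) }
    ; d       = λ (x , y) (x′ , y′) → A.d x x′ + B.d y y′
    ; d-refl  = λ (x , y) → cong₂ _+_ (A.d-refl x) (B.d-refl y)
    ; d-lip   = λ { (x , y) (inj₁ (refl , a)) → ≤-trans (+-monoʳ-≤ (A.d _ x) (B.d-lip y a)) (≤-reflexive (+-suc _ _))
                  ; (x , y) (inj₂ (refl , a)) → +-monoˡ-≤ (B.d _ y) (A.d-lip x a) }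
    ; d-walk  = λ (x , y) (x′ , y′) → walk-□ˡ y (A.d-walk x x′) ++ʷ walk-□ʳ x′ (B.d-walk y y′)
    }
    where
    module A = DistanceFunction A
    module B = DistanceFunction B

∣n-1+n∣≡1 : ∀ a → ∣ a - suc a ∣ ≡ 1
∣n-1+n∣≡1 a = trans (cong (∣ a -_∣) (+-comm 1 a)) (∣m-m+n∣≡n a 1)

∣suc-∣≤ : ∀ a b → ∣ suc a - b ∣ ≤ suc ∣ a - b ∣
∣suc-∣≤ a b = subst (∣ suc a - b ∣ ≤_) (cong (_+ ∣ a - b ∣) (trans (∣-∣-comm (suc a) a) (∣n-1+n∣≡1 a)))
  (∣-∣-triangle (suc a) a b)

∣-suc∣≤ : ∀ a b → ∣ a - b ∣ ≤ suc ∣ suc a - b ∣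
∣-suc∣≤ a zero    = ≤-trans (≤-reflexive (∣-∣-identityʳ a)) (≤-trans (n≤1+n a) (n≤1+n (suc a)))
∣-suc∣≤ a (suc b) = subst₂ (λ x y → x ≤ suc y) (∣-∣-comm (suc b) a) (∣-∣-comm b a) (∣suc-∣≤ b a)

module PathDistance (m : ℕ) where

  up-walk : ∀ k {x x′ : Fin m} → toℕ x′ ≡ k + toℕ x → Walk (P m) x x′ k
  up-walk zero eq = subst (λ y → Walk (P m) _ y 0) (toℕ-injective (sym eq)) here
  up-walk (suc k) {x} {x′} eq = step (inj₁ (sym (toℕ-fromℕ< lt)))
      (up-walk k (trans eq (trans (sym (+-suc k (toℕ x))) (cong (k +_) (sym (toℕ-fromℕ< lt))))))
    where
    lt : suc (toℕ x) < m
    lt = ≤-<-trans (s≤s (m≤n+m (toℕ x) k)) (subst (_< m) eq (toℕ<n x′))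

  path-sym : ∀ {x y} → PathAdj m x y → PathAdj m y x
  path-sym = swap

  pathDistance : DistanceFunction (P m)
  pathDistance = record
    { adj-sym = λ {x} {y} → path-sym {x} {y}
    ; d       = λ x y → ∣ toℕ x - toℕ y ∣
    ; d-refl  = λ x → ∣n-n∣≡0 (toℕ x)
    ; d-lip   = λ { {x} {y} w (inj₁ e) → subst (λ z → _ ≤ suc ∣ z - toℕ w ∣) e (∣-suc∣≤ (toℕ x) (toℕ w))
                  ; {x} {y} w (inj₂ e) → subst (λ z → ∣ z - toℕ w ∣ ≤ _) e (∣suc-∣≤ (toℕ y) (toℕ w)) }
    ; d-walk  = walk
    }
    where
    walk : ∀ x y → Walk (P m) x y ∣ toℕ x - toℕ y ∣
    walk x y with ≤-total (toℕ x) (toℕ y)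
    ... | inj₁ le = up-walk _ (trans (sym (m∸n+n≡m le)) (cong (_+ toℕ x) (sym (m≤n⇒∣m-n∣≡n∸m le))))
    ... | inj₂ le = reverseʷ (λ {x} {y} → path-sym {x} {y}) (up-walk _ (trans (sym (m∸n+n≡m le)) (cong (_+ toℕ y) (sym (m≤n⇒∣n-m∣≡n∸m le)))))

-- Distances on the cycle, with natural numbers modulo `n` as coordinates.

module CycleDistance (N : ℕ) where

  private
    n : ℕ
    n = suc N

  -- The shorter of the two arcs between positions `e` apart.
  cyc : ℕ → ℕ
  cyc e = e ⊓ (n ∸ e)

  -- Opaque so that arguments of pt and cdist can be inferred by unification.
  opaque
    pt : ℕ → Fin n
    pt a = a mod n

    toℕ-pt : ∀ a → toℕ (pt a) ≡ a % n
    toℕ-pt a = toℕ-fromℕ< (m%n<n a n)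

    cdist : Fin n → Fin n → ℕ
    cdist y z = cyc ∣ toℕ y - toℕ z ∣

    cdist-cyc : ∀ y z → cdist y z ≡ cyc ∣ toℕ y - toℕ z ∣
    cdist-cyc y z = refl

  pt-toℕ : ∀ y → y ≡ pt (toℕ y)
  pt-toℕ y = toℕ-injective (sym (trans (toℕ-pt (toℕ y)) (m<n⇒m%n≡m (toℕ<n y))))

  pt-period : ∀ a → pt a ≡ pt (a + n)
  pt-period a = toℕ-injective (trans (toℕ-pt a) (trans (sym ([m+n]%n≡m%n a n)) (sym (toℕ-pt (a + n)))))

  %-+ : ∀ a e → (a + e) % n ≡ (a % n + e) % n
  %-+ a e = trans (cong (_% n) lemma) ([m+kn]%n≡m%n (a % n + e) (a / n) n)
    where
    lemma : a + e ≡ a % n + e + (a / n) * n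
    lemma = trans (cong (_+ e) (m≡m%n+[m/n]*n a n))
      (trans (+-assoc (a % n) _ e) (trans (cong (a % n +_) (+-comm _ e)) (sym (+-assoc (a % n) e _))))

  pt-cong-+ : ∀ {a b} e → pt a ≡ pt b → pt (a + e) ≡ pt (b + e)
  pt-cong-+ {a} {b} e eq = toℕ-injective (begin
    toℕ (pt (a + e)) ≡⟨ toℕ-pt (a + e) ⟩
    (a + e) % n      ≡⟨ %-+ a e ⟩
    (a % n + e) % n  ≡⟨ cong (λ x → (x + e) % n) (trans (sym (toℕ-pt a)) (trans (cong toℕ eq) (toℕ-pt b))) ⟩
    (b % n + e) % n  ≡⟨ %-+ b e ⟨
    (b + e) % n      ≡⟨ toℕ-pt (b + e) ⟨
    toℕ (pt (b + e)) ∎)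
    where open ≡-Reasoning

  cyc-lip : ∀ {e e′} → e ≤ suc e′ → e′ ≤ suc e → cyc e ≤ suc (cyc e′)
  cyc-lip {e} {e′} p q = ⊓-mono-≤ p (m≤n+o⇒m∸n≤o n e (begin
    n                  ≤⟨ m≤n+m∸n n e′ ⟩
    e′ + (n ∸ e′)      ≤⟨ +-monoˡ-≤ (n ∸ e′) q ⟩
    suc e + (n ∸ e′)   ≡⟨ +-suc e (n ∸ e′) ⟨
    e + suc (n ∸ e′)   ∎))
    where open ≤-Reasoning

  cyc-top : ∀ {w} → w ≤ N → cyc ∣ N - w ∣ ≡ (N ∸ w) ⊓ suc w
  cyc-top {w} le = trans (cong cyc (m≤n⇒∣n-m∣≡n∸m le)) (cong ((N ∸ w) ⊓_)
    (trans (+-∸-assoc 1 (m∸n≤m N w)) (cong suc (m∸[m∸n]≡n le))))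

  cyc-bot : ∀ {w} → w ≤ N → cyc w ≡ w ⊓ suc (N ∸ w)
  cyc-bot {w} le = cong (w ⊓_) (+-∸-assoc 1 le)

  step-lip : ∀ {a b w} → w ≤ N → a < n → suc a % n ≡ b →
             (cyc ∣ a - w ∣ ≤ suc (cyc ∣ b - w ∣)) × (cyc ∣ b - w ∣ ≤ suc (cyc ∣ a - w ∣))
  step-lip {a} {b} {w} w≤N a<n eq with m≤n⇒m<n∨m≡n a<n
  ... | inj₁ lt with refl ← trans (sym eq) (m<n⇒m%n≡m lt) =
    cyc-lip (∣-suc∣≤ a w) (∣suc-∣≤ a w) , cyc-lip (∣suc-∣≤ a w) (∣-suc∣≤ a w)
  -- The edge wraps from `N` to `0`. Here the difference to `w` jumps from `N ∸ w` to `w`, so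
  -- `cyc-lip` does not apply and the two minima are compared directly.
  ... | inj₂ refl with refl ← trans (sym eq) (n%n≡0 n) =
    subst₂ (λ x y → x ≤ suc y) (sym (cyc-top w≤N)) (sym (cyc-bot w≤N))
      (≤-trans (≤-reflexive (⊓-comm (N ∸ w) (suc w))) (⊓-monoʳ-≤ (suc w) (m≤n+m (N ∸ w) 2))) ,
    subst₂ (λ x y → x ≤ suc y) (sym (cyc-bot w≤N)) (sym (cyc-top w≤N))
      (≤-trans (≤-reflexive (⊓-comm w _)) (⊓-monoʳ-≤ (suc (N ∸ w)) (m≤n+m w 2)))

  adj-pt : ∀ a → CycleAdj n (pt a) (pt (suc a))
  adj-pt a = inj₁ (begin
    suc (toℕ (pt a)) % n ≡⟨ cong (λ x → suc x % n) (toℕ-pt a) ⟩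
    suc (a % n) % n      ≡⟨ cong (_% n) (+-comm 1 (a % n)) ⟩
    (a % n + 1) % n      ≡⟨ %-+ a 1 ⟨
    (a + 1) % n          ≡⟨ cong (_% n) (+-comm a 1) ⟩
    suc a % n            ≡⟨ toℕ-pt (suc a) ⟨
    toℕ (pt (suc a))     ∎)
    where open ≡-Reasoning

  arc-walk : ∀ a e → Walk (C n) (pt a) (pt (a + e)) e
  arc-walk a zero    = subst (λ x → Walk (C n) (pt a) (pt x) 0) (sym (+-identityʳ a)) here
  arc-walk a (suc e) = step (adj-pt a)
    (subst (λ x → Walk (C n) (pt (suc a)) (pt x) e) (sym (+-suc a e)) (arc-walk (suc a) e))

  cycle-sym : ∀ {x y} → CycleAdj n x y → CycleAdj n y x
  cycle-sym = swap

  forward : ∀ {y z : Fin n} → toℕ y ≤ toℕ z → z ≡ pt (toℕ y + ∣ toℕ y - toℕ z ∣)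
  forward {y} {z} le = trans (pt-toℕ z)
    (cong pt (sym (trans (cong (toℕ y +_) (m≤n⇒∣m-n∣≡n∸m le)) (m+[n∸m]≡n le))))

  ∣-∣≤n : ∀ (y z : Fin n) → ∣ toℕ y - toℕ z ∣ ≤ n
  ∣-∣≤n y z = ≤-trans (∣m-n∣≤m⊔n (toℕ y) (toℕ z)) (⊔-lub (<⇒≤ (toℕ<n y)) (<⇒≤ (toℕ<n z)))

  -- The complementary arc: going on from `z` for the remaining `n ∸ e` steps wraps around once and
  -- returns to `y`.
  backward : ∀ {y z : Fin n} → toℕ y ≤ toℕ z → y ≡ pt (toℕ z + (n ∸ ∣ toℕ y - toℕ z ∣))
  backward {y} {z} le = trans (trans (pt-toℕ y) (pt-period (toℕ y))) (cong pt (begin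
    toℕ y + n                ≡⟨ cong (toℕ y +_) (m+[n∸m]≡n (∣-∣≤n y z)) ⟨
    toℕ y + (e + (n ∸ e))    ≡⟨ +-assoc (toℕ y) e (n ∸ e) ⟨
    toℕ y + e + (n ∸ e)      ≡⟨ cong (_+ (n ∸ e)) (trans (cong (toℕ y +_) (m≤n⇒∣m-n∣≡n∸m le)) (m+[n∸m]≡n le)) ⟩
    toℕ z + (n ∸ e)          ∎))
    where
    open ≡-Reasoning
    e = ∣ toℕ y - toℕ z ∣

  up-walk : ∀ {y z} → toℕ y ≤ toℕ z → Walk (C n) y z (cyc ∣ toℕ y - toℕ z ∣)
  up-walk {y} {z} le with ⊓-sel ∣ toℕ y - toℕ z ∣ (n ∸ ∣ toℕ y - toℕ z ∣)
  ... | inj₁ eq = subst (Walk (C n) y z) (sym eq)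
        (subst₂ (λ u v → Walk (C n) u v e) (sym (pt-toℕ y)) (sym (forward le)) (arc-walk (toℕ y) e))
    where e = ∣ toℕ y - toℕ z ∣
  ... | inj₂ eq = subst (Walk (C n) y z) (sym eq) (reverseʷ (λ {x} {y} → cycle-sym {x} {y})
        (subst₂ (λ u v → Walk (C n) u v e) (sym (pt-toℕ z)) (sym (backward le)) (arc-walk (toℕ z) e)))
    where e = n ∸ ∣ toℕ y - toℕ z ∣

  cycleDistance : DistanceFunction (C n)
  cycleDistance = record
    { adj-sym = λ {x} {y} → cycle-sym {x} {y}
    ; d       = cdist
    ; d-refl  = λ y → trans (cdist-cyc y y) (cong cyc (∣n-n∣≡0 (toℕ y)))
    ; d-lip   = λ {y} {z} w a → subst₂ (λ p q → p ≤ suc q) (sym (cdist-cyc y w)) (sym (cdist-cyc z w)) (lip w a)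
    ; d-walk  = λ y z → subst (Walk (C n) y z) (sym (cdist-cyc y z)) (walk y z)
    }
    where
    lip : ∀ {y z} w → CycleAdj n y z → cyc ∣ toℕ y - toℕ w ∣ ≤ suc (cyc ∣ toℕ z - toℕ w ∣)
    lip {y} {z} w (inj₁ e) = proj₁ (step-lip (≤-pred (toℕ<n w)) (toℕ<n y) e)
    lip {y} {z} w (inj₂ e) = proj₂ (step-lip (≤-pred (toℕ<n w)) (toℕ<n z) e)

    walk : ∀ y z → Walk (C n) y z (cyc ∣ toℕ y - toℕ z ∣)
    walk y z with ≤-total (toℕ y) (toℕ z)
    ... | inj₁ le = up-walk le
    ... | inj₂ le = subst (Walk (C n) y z) (cong cyc (∣-∣-comm (toℕ z) (toℕ y)))
                      (reverseʷ (λ {x} {y} → cycle-sym {x} {y}) (up-walk le))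

  open DistanceFunction cycleDistance public using (d; d-sym)

  cyc-small : ∀ {e} → e + e ≤ n → cyc e ≡ e
  cyc-small {e} le = m≤n⇒m⊓n≡m (m+n≤o⇒m≤o∸n e le)

  cyc-flip : ∀ {e} → e ≤ n → cyc (n ∸ e) ≡ cyc e
  cyc-flip {e} le = trans (cong ((n ∸ e) ⊓_) (m∸[m∸n]≡n le)) (⊓-comm (n ∸ e) e)

  arc : ∀ a e → e ≤ n → d (pt a) (pt (a + e)) ≡ cyc e
  arc a e e≤n = trans (trans (cdist-cyc (pt a) (pt (a + e)))
    (cong₂ (λ x y → cyc ∣ x - y ∣) (toℕ-pt a) (trans (toℕ-pt (a + e)) (%-+ a e)))) (residues (m≤n⇒m<n∨m≡n e≤n))
    where
    a₀ : ℕ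
    a₀ = a % n
    a₀<n : a₀ < n
    a₀<n = m%n<n a n
    residues : e < n ⊎ e ≡ n → cyc ∣ a₀ - (a₀ + e) % n ∣ ≡ cyc e
    residues (inj₂ refl) = trans (cong (λ x → cyc ∣ a₀ - x ∣) (trans ([m+n]%n≡m%n a₀ n) (m<n⇒m%n≡m a₀<n)))
      (trans (cong cyc (∣n-n∣≡0 a₀)) (sym (cong (n ⊓_) (n∸n≡0 n))))
    residues (inj₁ e<n) with a₀ + e <? n
    ... | yes lt = trans (cong (λ x → cyc ∣ a₀ - x ∣) (m<n⇒m%n≡m lt)) (cong cyc (∣m-m+n∣≡n a₀ e))
    -- After wrapping, the residues differ by `n ∸ e` instead of `e`, and `cyc` does not distinguish
    -- the two.
    ... | no ¬lt = trans (cong (λ x → cyc ∣ a₀ - x ∣) wrap) (trans (cong cyc gap) (cyc-flip e≤n))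
      where
      x = a₀ + e ∸ n
      x+n : x + n ≡ a₀ + e
      x+n = m∸n+n≡m (≮⇒≥ ¬lt)
      x<n : x < n
      x<n = +-cancelʳ-< n x n (subst (_< n + n) (sym x+n) (+-mono-< a₀<n e<n))
      wrap : (a₀ + e) % n ≡ x
      wrap = trans (cong (_% n) (sym x+n)) (trans ([m+n]%n≡m%n x n) (m<n⇒m%n≡m x<n))
      x+gap : x + (n ∸ e) ≡ a₀
      x+gap = +-cancelʳ-≡ e _ _ (trans (+-assoc x (n ∸ e) e) (trans (cong (x +_) (m∸n+n≡m e≤n)) x+n))
      gap : ∣ a₀ - x ∣ ≡ n ∸ e
      gap = trans (cong (∣_- x ∣) (sym x+gap)) (trans (∣-∣-comm (x + (n ∸ e)) x) (∣m-m+n∣≡n x (n ∸ e)))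

  -- Arcs, reflections and antipodes on the cycle.

  arcˡ : ∀ {x x′ a a′} e → e + e ≤ n → x ≡ pt a → x′ ≡ pt a′ → a + e ≡ a′ → d x x′ ≡ e
  arcˡ {a = a} e le refl refl refl = trans (arc a e (m+n≤o⇒m≤o e le)) (cyc-small le)

  arcʳ : ∀ {x x′ a a′} e → e + e ≤ n → x ≡ pt a → x′ ≡ pt a′ → a + e ≡ a′ → d x′ x ≡ e
  arcʳ {x} {x′} e le p q eq = trans (d-sym x′ x) (arcˡ e le p q eq)

  -- Records which endpoint the arc starts from, so that the arguments below can pick coordinates
  -- that only increase.
  data Arc (q : ℕ) (y z : Fin n) : Set where
    fwd : ∀ a → y ≡ pt a → z ≡ pt (a + q) → Arc q y z
    bwd : ∀ a → z ≡ pt a → y ≡ pt (a + q) → Arc q y z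

  flip-arc : ∀ {q y z} → Arc q y z → Arc q z y
  flip-arc (fwd a p q) = bwd a p q
  flip-arc (bwd a p q) = fwd a p q

  d-small : ∀ y z → d y z + d y z ≤ n
  d-small y z = subst (λ x → x + x ≤ n) (sym (cdist-cyc y z))
    (≤-trans (+-mono-≤ (m⊓n≤m e (n ∸ e)) (m⊓n≤n e (n ∸ e))) (≤-reflexive (m+[n∸m]≡n (∣-∣≤n y z))))
    where
    e = ∣ toℕ y - toℕ z ∣

  up-arc : ∀ {y z} → toℕ y ≤ toℕ z → Arc (d y z) y z
  up-arc {y} {z} le with ⊓-sel ∣ toℕ y - toℕ z ∣ (n ∸ ∣ toℕ y - toℕ z ∣)
  ... | inj₁ eq = fwd (toℕ y) (pt-toℕ y)
        (trans (forward le) (cong (λ x → pt (toℕ y + x)) (sym (trans (cdist-cyc y z) eq))))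
  ... | inj₂ eq = bwd (toℕ z) (pt-toℕ z)
        (trans (backward le) (cong (λ x → pt (toℕ z + x)) (sym (trans (cdist-cyc y z) eq))))

  shortest-arc : ∀ y z → Arc (d y z) y z
  shortest-arc y z with ≤-total (toℕ y) (toℕ z)
  ... | inj₁ le = up-arc le
  ... | inj₂ le = flip-arc (subst (λ q → Arc q z y) (d-sym z y) (up-arc le))

  arc-of : ∀ {q y z} → d y z ≡ q → Arc q y z
  arc-of {y = y} {z} refl = shortest-arc y z

  neighbour : 2 ≤ n → ∀ y → ∃ λ y′ → d y y′ ≡ 1
  neighbour 2≤n y = pt (toℕ y + 1) , arcˡ 1 2≤n (pt-toℕ y) refl refl

  -- z′ is the mirror image of z in y, and y′ the neighbour of y towards z′.
  reflect : ∀ {y z} q → d y z ≡ suc q → suc (suc q) + suc (suc q) ≤ n →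
    ∃ λ y′ → ∃ λ z′ → d y y′ ≡ 1 × d y′ z ≡ suc (suc q) × d y z′ ≡ suc q × d y′ z′ ≡ q
  reflect {y} {z} q yz le with arc-of yz
  ... | fwd a p r = pt (a′ + q) , pt a′ ,
      arcʳ 1 le₁ refl y≡ (trans (+-assoc a′ q 1) (cong (a′ +_) (+-comm q 1))) ,
      arcˡ (suc (suc q)) le refl z≡ (trans (+-assoc a′ q _)
        (trans (cong (a′ +_) (+-suc q (suc q))) (sym (+-assoc a′ (suc q) (suc q))))) ,
      arcʳ (suc q) le₂ refl y≡ refl ,
      arcʳ q le₃ refl refl refl
    where
    le₂ = ≤-trans (+-mono-≤ (n≤1+n (suc q)) (n≤1+n (suc q))) le
    le₃ = ≤-trans (+-mono-≤ (n≤1+n q) (n≤1+n q)) le₂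
    le₁ = ≤-trans (+-mono-≤ (s≤s (z≤n {suc q})) (s≤s (z≤n {suc q}))) le
    -- Stands for `a - (q + 1)` modulo `n`: the mirror image lies behind `y`, and it is reached by
    -- going forward around the cycle.
    a′ = a + (n ∸ suc q)
    a′+ : a′ + suc q ≡ a + n
    a′+ = trans (+-assoc a (n ∸ suc q) (suc q)) (cong (a +_) (m∸n+n≡m (m+n≤o⇒m≤o (suc q) le₂)))
    ya : pt (a′ + suc q) ≡ pt a
    ya = trans (cong pt a′+) (sym (pt-period a))
    y≡ : y ≡ pt (a′ + suc q)
    y≡ = trans p (sym ya)
    z≡ : z ≡ pt (a′ + suc q + suc q)
    z≡ = trans r (pt-cong-+ (suc q) (sym ya))
  ... | bwd a p r = pt (a + suc (suc q)) , pt (a + suc q + suc q) ,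
      arcˡ 1 le₁ r refl (trans (+-assoc a (suc q) 1) (cong (a +_) (+-comm (suc q) 1))) ,
      arcʳ (suc (suc q)) le p refl refl ,
      arcˡ (suc q) le₂ r refl refl ,
      arcˡ q le₃ refl refl (trans (+-assoc a (suc (suc q)) q)
        (trans (cong (a +_) (sym (+-suc (suc q) q))) (sym (+-assoc a (suc q) (suc q)))))
    where
    le₂ = ≤-trans (+-mono-≤ (n≤1+n (suc q)) (n≤1+n (suc q))) le
    le₃ = ≤-trans (+-mono-≤ (n≤1+n q) (n≤1+n q)) le₂
    le₁ = ≤-trans (+-mono-≤ (s≤s (z≤n {suc q})) (s≤s (z≤n {suc q}))) le

  -- On an odd cycle `y` has two adjacent antipodes, `z` and `z′`. Moving `y` one step towards `z`
  -- gives `y′`, which still has `z′` as an antipode.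
  odd-antipodes : ∀ {h y z} → n ≡ suc (suc h + suc h) → d y z ≡ suc h →
    ∃ λ y′ → ∃ λ z′ → d y z′ ≡ suc h × d z z′ ≡ 1 × d y y′ ≡ 1 × d y′ z ≡ h × d y′ z′ ≡ suc h
  odd-antipodes {h} {y} {z} odd yz with arc-of yz
  ... | fwd a p r = pt (a + 1) , pt (a + 1 + suc h) ,
      arcʳ (suc h) le refl (trans p (pt-period a)) around ,
      arcˡ 1 le₁ r refl (trans (+-assoc a (suc h) 1) (trans (cong (a +_) (+-comm (suc h) 1)) (sym (+-assoc a 1 (suc h))))) ,
      arcˡ 1 le₁ p refl refl ,
      arcˡ h le₂ refl r (+-assoc a 1 h) ,
      arcˡ (suc h) le refl refl refl
    where
    le : suc h + suc h ≤ n
    le = subst (suc h + suc h ≤_) (sym odd) (n≤1+n _)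
    le₂ = ≤-trans (+-mono-≤ (n≤1+n h) (n≤1+n h)) le
    le₁ = ≤-trans (+-mono-≤ (s≤s (z≤n {h})) (s≤s (z≤n {h}))) le
    around : a + 1 + suc h + suc h ≡ a + n
    around = trans (+-assoc (a + 1) (suc h) (suc h)) (trans (+-assoc a 1 _) (cong (a +_) (sym odd)))
  -- The second coordinate stands for `a - 1`, as `n` is one more than `suc h + suc h`.
  ... | bwd a p r = pt (a + h) , pt (a + suc h + suc h) ,
      arcˡ (suc h) le r refl refl ,
      arcʳ 1 le₁ refl (trans p (pt-period a)) around ,
      arcʳ 1 le₁ refl r (trans (+-assoc a h 1) (cong (a +_) (+-comm h 1))) ,
      arcʳ h le₂ p refl refl ,
      arcʳ (suc h) le refl (pt-period (a + h)) around′
    where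
    le : suc h + suc h ≤ n
    le = subst (suc h + suc h ≤_) (sym odd) (n≤1+n _)
    le₂ = ≤-trans (+-mono-≤ (n≤1+n h) (n≤1+n h)) le
    le₁ = ≤-trans (+-mono-≤ (s≤s (z≤n {h})) (s≤s (z≤n {h}))) le
    around : a + suc h + suc h + 1 ≡ a + n
    around = trans (+-comm _ 1) (trans (cong suc (+-assoc a (suc h) (suc h)))
      (trans (sym (+-suc a _)) (cong (a +_) (sym odd))))
    around′ : a + suc h + suc h + suc h ≡ a + h + n
    around′ = trans (trans (cong (λ x → x + suc h + suc h) (trans (+-suc a h) (+-comm 1 (a + h))))
      (trans (+-assoc (a + h + 1) (suc h) (suc h)) (+-assoc (a + h) 1 _))) (cong (a + h +_) (sym odd))

  -- An arc of half the circumference reaches the same vertex in either direction, so the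
  -- orientation may be chosen freely.
  antipode : ∀ {h b y z} → n ≡ h + h → d y z ≡ h → y ≡ pt b → z ≡ pt (b + h)
  antipode {h} {b} even yz y≡b with arc-of yz
  ... | fwd a p r = trans r (pt-cong-+ h (trans (sym p) y≡b))
  ... | bwd a p r = trans p (trans (pt-period a) (trans
        (cong pt (trans (cong (a +_) even) (sym (+-assoc a h h)))) (pt-cong-+ h (trans (sym r) y≡b))))

  -- Whichever way the shortest arc from `y` to `v` runs, it continues in the same direction to the
  -- unique antipode `z`.
  even-antipodes : ∀ {h y z} → n ≡ h + h → d y z ≡ h → ∀ v → d y v + d v z ≡ h
  even-antipodes {h} {y} {z} even yz v =
    trans (cong (i +_) (vz (shortest-arc y v))) (m+[n∸m]≡n i≤h)
    where
    i = d y v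
    i≤h : i ≤ h
    i≤h = ≮⇒≥ λ lt → <⇒≱ (subst (_< i + i) (sym even) (+-mono-< lt lt)) (d-small y v)
    le : (h ∸ i) + (h ∸ i) ≤ n
    le = ≤-trans (+-mono-≤ (m∸n≤m h i) (m∸n≤m h i)) (≤-reflexive (sym even))
    vz : Arc i y v → d v z ≡ h ∸ i
    vz (fwd b p r) = arcˡ (h ∸ i) le r (antipode even yz p)
      (trans (+-assoc b i (h ∸ i)) (cong (b +_) (m+[n∸m]≡n i≤h)))
    vz (bwd b p r) = arcʳ (h ∸ i) le (antipode even yz r) (trans p (pt-period b))
      (trans (trans (cong (_+ (h ∸ i)) (trans (+-assoc b i h) (trans (cong (b +_) (+-comm i h)) (sym (+-assoc b h i)))))
         (trans (+-assoc (b + h) i (h ∸ i)) (cong (b + h +_) (m+[n∸m]≡n i≤h))))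
       (trans (+-assoc b h h) (cong (b +_) (sym even))))

-- Extensions and antipodes in the path.

module PathFacts (M : ℕ) where
  open PathDistance (suc M)
  open DistanceFunction pathDistance public using (d; d-sym)

  d≤M : ∀ x y → d x y ≤ M
  d≤M x y = ≤-trans (∣m-n∣≤m⊔n (toℕ x) (toℕ y)) (⊔-lub (≤-pred (toℕ<n x)) (≤-pred (toℕ<n y)))

  predecessor : ∀ {a} (x : Fin (suc M)) → toℕ x ≡ suc a → ∃ λ x′ → toℕ x′ ≡ a
  predecessor {a} x eq = fromℕ< lt , toℕ-fromℕ< lt
    where
    lt : a < suc M
    lt = <-trans (n<1+n a) (subst (_< suc M) eq (toℕ<n x))

  successor : ∀ (x : Fin (suc M)) → toℕ x < M → ∃ λ x′ → toℕ x′ ≡ suc (toℕ x)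
  successor x lt = fromℕ< (s≤s lt) , toℕ-fromℕ< (s≤s lt)

  neighbour : 1 ≤ M → ∀ x → ∃ λ x′ → d x x′ ≡ 1
  neighbour 1≤M x with toℕ x in eq
  ... | zero  = let x′ , e = successor x (subst (_< M) (sym eq) 1≤M) in
                x′ , trans e (cong suc eq)
  ... | suc a = let x′ , e = predecessor x eq in
                x′ , trans (cong (∣ suc a -_∣) e) (trans (∣-∣-comm (suc a) a) (∣n-1+n∣≡1 a))

  Extension : (x y : Fin (suc M)) → Set
  Extension x y = ∃ λ x′ → d x x′ ≡ 1 × d x′ y ≡ suc (d x y)

  extend-up : ∀ {x y} → toℕ x ≤ toℕ y → d x y < M → Extension x y ⊎ Extension y x
  extend-up {x} {y} le lt with toℕ x in eq
  ... | zero  = let y′ , e = successor y lt in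
                inj₂ (y′ , trans (cong (∣ toℕ y -_∣) e) (∣n-1+n∣≡1 (toℕ y)) ,
                  trans (∣-∣-identityʳ (toℕ y′)) (trans e (cong suc (sym (∣-∣-identityʳ (toℕ y))))))
  ... | suc a = let x′ , e = predecessor x eq in
                inj₁ (x′ , trans (cong (∣ suc a -_∣) e) (trans (∣-∣-comm (suc a) a) (∣n-1+n∣≡1 a)) ,
                  (begin
                    ∣ toℕ x′ - toℕ y ∣    ≡⟨ cong (∣_- toℕ y ∣) e ⟩
                    ∣ a - toℕ y ∣         ≡⟨ m≤n⇒∣m-n∣≡n∸m (<⇒≤ le) ⟩
                    toℕ y ∸ a             ≡⟨ +-∸-assoc 1 le ⟩
                    suc (toℕ y ∸ suc a)   ≡⟨ cong suc (m≤n⇒∣m-n∣≡n∸m le) ⟨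
                    suc ∣ suc a - toℕ y ∣ ∎))
    where open ≡-Reasoning

  -- Below the maximal distance `x` and `y` are not the two ends of the path, so one of them can
  -- step outwards.
  extend : ∀ x y → d x y < M → Extension x y ⊎ Extension y x
  extend x y lt with ≤-total (toℕ x) (toℕ y)
  ... | inj₁ le = extend-up le lt
  ... | inj₂ le = swap (extend-up le (subst (_< M) (d-sym x y) lt))

  -- Distance `M` forces `x` and `y` to be the two ends of the path.
  antipodes-up : ∀ {x y} → toℕ x ≤ toℕ y → d x y ≡ M → ∀ v → d x v + d v y ≡ M
  antipodes-up {x} {y} le eq v = begin
    ∣ toℕ x - toℕ v ∣ + ∣ toℕ v - toℕ y ∣ ≡⟨ cong₂ (λ a b → ∣ a - toℕ v ∣ + ∣ toℕ v - b ∣) x≡0 y≡M ⟩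
    toℕ v + ∣ toℕ v - M ∣                 ≡⟨ cong (toℕ v +_) (m≤n⇒∣m-n∣≡n∸m v≤M) ⟩
    toℕ v + (M ∸ toℕ v)                   ≡⟨ m+[n∸m]≡n v≤M ⟩
    M                                     ∎
    where
    open ≡-Reasoning
    v≤M : toℕ v ≤ M
    v≤M = ≤-pred (toℕ<n v)
    x+M≡y : toℕ x + M ≡ toℕ y
    x+M≡y = trans (cong (toℕ x +_) (trans (sym eq) (m≤n⇒∣m-n∣≡n∸m le))) (m+[n∸m]≡n le)
    x≡0 : toℕ x ≡ 0
    x≡0 = n≤0⇒n≡0 (+-cancelʳ-≤ M (toℕ x) 0 (subst (_≤ M) (sym x+M≡y) (≤-pred (toℕ<n y))))
    y≡M : toℕ y ≡ M
    y≡M = trans (sym x+M≡y) (cong (_+ M) x≡0)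

  antipodes : ∀ {x y} → d x y ≡ M → ∀ v → d x v + d v y ≡ M
  antipodes {x} {y} eq v with ≤-total (toℕ x) (toℕ y)
  ... | inj₁ le = antipodes-up le eq v
  ... | inj₂ le = trans (+-comm (d x v) (d v y)) (trans (cong₂ _+_ (d-sym v y) (d-sym x v))
                    (antipodes-up le (trans (d-sym y x) eq) v))

-- Minimal configurations in the cylinder.

-- Here m = M + 1, n = N + 1 and h = ⌊n/2⌋, so the diameter is M + h.
module Cylinder (M N h : ℕ) (1≤M : 1 ≤ M) (2≤N : 2 ≤ N)
  (lower : h + h ≤ suc N) (upper : suc N ≤ suc (h + h)) where

  open PathDistance (suc M) using (pathDistance)
  open CycleDistance N using (cycleDistance)
  private
    module PF = PathFacts M
    module CF = CycleDistance N
    module A = DistanceFunction pathDistance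
    module B = DistanceFunction cycleDistance
    G : Graph
    G = P (suc M) □ C (suc N)

  cylinderDistance : DistanceFunction G
  cylinderDistance = product-distance pathDistance cycleDistance

  open DistanceFunction cylinderDistance public using (d; d-refl; d-zero; d-sym; d-split; dist; dist-unique; isGeodesic)

  sum≡ : ∀ {a b i j l} → a ≡ i → b ≡ j → i + j ≡ l → a + b ≡ l
  sum≡ refl refl eq = eq

  cycle≤h : ∀ y z → B.d y z ≤ h
  cycle≤h y z = ≮⇒≥ λ lt → <⇒≱ (≤-<-trans upper (s≤s (n<1+n (h + h))))
    (≤-trans (subst (_≤ B.d y z + B.d y z) (cong suc (+-suc h h)) (+-mono-≤ lt lt)) (CF.d-small y z))

  1≤h : 1 ≤ h
  1≤h = positive h upper
    where
    positive : ∀ h → suc N ≤ suc (h + h) → 1 ≤ h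
    positive zero    le = ⊥-elim (<⇒≱ 2≤N (≤-trans (≤-pred le) z≤n))
    positive (suc h) le = s≤s z≤n

  h⁺ : suc (pred h) ≡ h
  h⁺ = suc-pred h {{>-nonZero 1≤h}}

  module _ {r : ℕ} (c : V G → Fin r) where
    open Colouring d c

    module Antipodal (free : RainbowFree) (k : ℕ) (none-below : NoneBelow k) where
      open Minimal isGeodesic free k none-below

      k⁺ : ∀ {ρ b w} → Separated k ρ b w → suc (pred k) ≡ k
      k⁺ S = suc-pred k {{≢-nonZero (k≢0 S)}}

      -- Each end slides one step inwards along the cycle and one step sideways to a neighbour `x′`.
      -- It stays at `k + 1` from the opposite original end, but the two slid ends are only `k - 1`
      -- apart.
      same-path-vertex : ∀ {ρ x y₁ y₂} → ¬ Separated k ρ (x , y₁) (x , y₂)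
      same-path-vertex {x = x} {y₁} {y₂} S
        with PF.neighbour 1≤M x
           | B.d-trim (pred k) (trans (cong (_+ B.d y₁ y₂) (sym (A.d-refl x))) (trans (ends S) (cong suc (sym (k⁺ S)))))
      ... | x′ , xx′ | y₁′ , y₂′ , e₁ , e₂ , f₁ , f₂ , g = no-double-slide S
        {x , y₁′} {x′ , y₁′} {x , y₂′} {x′ , y₂′}
        (sum≡ (A.d-refl x) e₁ refl) (sum≡ (A.d-refl x) e₂ (k⁺ S))
        (sum≡ x′x (B.d-refl y₁′) refl) (sum≡ x′x e₂ (cong suc (k⁺ S)))
        (sum≡ (A.d-refl x) f₁ refl) (sum≡ (A.d-refl x) f₂ (k⁺ S))
        (sum≡ x′x (B.d-refl y₂′) refl) (sum≡ x′x f₂ (cong suc (k⁺ S)))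
        (≤-reflexive (trans (cong suc (sum≡ (A.d-refl x′) g refl)) (k⁺ S)))
        where
        x′x : A.d x′ x ≡ 1
        x′x = trans (A.d-sym x′ x) xx′

      -- As before with the factors exchanged: inwards along the path, sideways along the cycle.
      same-cycle-vertex : ∀ {ρ x₁ x₂ y} → ¬ Separated k ρ (x₁ , y) (x₂ , y)
      same-cycle-vertex {x₁ = x₁} {x₂} {y} S
        with CF.neighbour (≤-trans 2≤N (n≤1+n N)) y
           | A.d-trim (pred k) {x₁} {x₂} (trans (sym (trans (cong (A.d x₁ x₂ +_) (B.d-refl y)) (+-identityʳ _)))
               (trans (ends S) (cong suc (sym (k⁺ S)))))
      ... | y′ , yy′ | x₁′ , x₂′ , e₁ , e₂ , f₁ , f₂ , g = no-double-slide S
        {x₁′ , y} {x₁′ , y′} {x₂′ , y} {x₂′ , y′}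
        (sum≡ e₁ (B.d-refl y) refl) (sum≡ e₂ (B.d-refl y) (trans (+-identityʳ _) (k⁺ S)))
        (sum≡ (A.d-refl x₁′) y′y refl) (sum≡ e₂ y′y (trans (+-comm _ 1) (cong suc (k⁺ S))))
        (sum≡ f₁ (B.d-refl y) refl) (sum≡ f₂ (B.d-refl y) (trans (+-identityʳ _) (k⁺ S)))
        (sum≡ (A.d-refl x₂′) y′y refl) (sum≡ f₂ y′y (trans (+-comm _ 1) (cong suc (k⁺ S))))
        (≤-reflexive (trans (cong suc (sum≡ g (B.d-refl y′) (+-identityʳ _))) (k⁺ S)))
        where
        y′y : B.d y′ y ≡ 1
        y′y = trans (B.d-sym y′ y) yy′

      -- When both coordinates differ, `j < h` leaves room to step away from `y₂` on the cycle, so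
      -- `b` slides to `(x′ , y′)`, nearer on the path and farther on the cycle. The mirror image
      -- `(x₂ , z′)` of `w` is only `k - 1` from there, and the corner `(x₂ , y₁)` is equidistant
      -- from `w` and its image.
      below : ∀ {ρ x₁ y₁ x₂ y₂} i j → A.d x₁ x₂ ≡ i → B.d y₁ y₂ ≡ j → j < h →
              ¬ Separated k ρ (x₁ , y₁) (x₂ , y₂)
      below {x₁ = x₁} {x₂ = x₂} zero j p q lt S with refl ← A.d-zero {x₁} {x₂} p = same-path-vertex S
      below (suc i) zero p q lt S with refl ← B.d-zero q = same-cycle-vertex S
      below {x₁ = x₁} {y₁} {x₂} {y₂} (suc i) (suc j) p q lt S
        with A.d-split 1 i {x₁} {x₂} p | CF.reflect j q (≤-trans (+-mono-≤ lt lt) lower)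
      ... | x′ , xx′ , x′x | y′ , z′ , yy′ , y′z , yz′ , y′z′ = no-reflection S
        {x′ , y₁} {x′ , y′} {x₂ , z′} {x₂ , y₁} i j
        (sum≡ xx′ (B.d-refl y₁) refl) (sum≡ x′x q i+1+j)
        (sum≡ (A.d-refl x′) (trans (B.d-sym y′ y₁) yy′) refl) (sum≡ x′x y′z (trans (+-suc i (suc j)) total))
        (sum≡ p yz′ total) (subst₂ _<_ (sym (sum≡ x′x y′z′ refl)) i+1+j (+-monoʳ-< i (n<1+n j)))
        (sum≡ p (B.d-refl y₁) (+-identityʳ (suc i))) (sum≡ (A.d-refl x₂) q refl) total
        (sum≡ (A.d-refl x₂) yz′ refl)
        where
        total : suc i + suc j ≡ suc k
        total = trans (sym (cong₂ _+_ p q)) (ends S)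
        i+1+j : i + suc j ≡ k
        i+1+j = suc-injective total

      -- Sliding `b` outwards on the path and inwards on the cycle brings the cycle distance down to
      -- `h - 1`, where `below` applies.
      no-extension : ∀ {ρ x₁ y₁ x₂ y₂} → B.d y₁ y₂ ≡ h → PF.Extension x₁ x₂ →
                     ¬ Separated k ρ (x₁ , y₁) (x₂ , y₂)
      no-extension {x₁ = x₁} {y₁} {x₂} {y₂} q (x′ , xx′ , x′x₂) S
        with B.d-split 1 (pred h) (trans q (sym h⁺))
      ... | y′ , yy′ , y′y₂ = below (suc (A.d x₁ x₂)) (pred h) x′x₂ y′y₂ (≤-reflexive h⁺)
        (slide S {x₁ , y′} {x′ , y′}
          (sum≡ (A.d-refl x₁) yy′ refl) (sum≡ refl y′y₂ (suc-injective total))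
          (sum≡ (trans (A.d-sym x′ x₁) xx′) (B.d-refl y′) refl) (sum≡ x′x₂ y′y₂ total))
        where
        total : suc (A.d x₁ x₂ + pred h) ≡ suc k
        total = trans (sym (+-suc (A.d x₁ x₂) (pred h))) (trans (cong (A.d x₁ x₂ +_) (trans h⁺ (sym q))) (ends S))

      antipodal : ∀ {ρ x₁ y₁ x₂ y₂} → Separated k ρ (x₁ , y₁) (x₂ , y₂) → A.d x₁ x₂ ≡ M × B.d y₁ y₂ ≡ h
      antipodal {x₁ = x₁} {y₁} {x₂} {y₂} S with m≤n⇒m<n∨m≡n (cycle≤h y₁ y₂) | m≤n⇒m<n∨m≡n (PF.d≤M x₁ x₂)
      ... | inj₁ lt | _ = ⊥-elim (below _ _ refl refl lt S)
      ... | inj₂ q  | inj₂ p = p , q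
      ... | inj₂ q  | inj₁ lt with PF.extend x₁ x₂ lt
      ... | inj₁ ext = ⊥-elim (no-extension q ext S)
      ... | inj₂ ext = ⊥-elim (no-extension (trans (B.d-sym y₂ y₁) q) ext (flip-ends S))

      length≡ : ∀ {ρ b w} → Separated k ρ b w → M + h ≡ suc k
      length≡ S = let p , q = antipodal S in trans (sym (cong₂ _+_ p q)) (ends S)

      no-odd-cycle : suc N ≡ suc (h + h) → ∀ {ρ b w} → ¬ Separated k ρ b w
      no-odd-cycle odd {b = x₁ , y₁} {x₂ , y₂} S with antipodal S
      ... | p , q with CF.odd-antipodes {pred h} (subst (λ h → suc N ≡ suc (h + h)) (sym h⁺) odd) (trans q (sym h⁺))
      ... | y′ , z′ , yz′ , zz′ , yy′ , y′z , y′z′ = no-adjacent-antipodes S {x₁ , y′} {x₂ , z′}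
        (sum≡ p yz′ full) (sum≡ (A.d-refl x₂) zz′ refl) (sum≡ (A.d-refl x₁) yy′ refl)
        (sum≡ p y′z (suc-injective (trans (sym (+-suc M (pred h))) full))) (sum≡ p y′z′ full)
        where
        full : M + suc (pred h) ≡ suc k
        full = trans (cong (M +_) h⁺) (length≡ S)

      no-even-diameter : 2 ∣ M + h → ∀ {ρ b w} → ¬ Separated k ρ b w
      no-even-diameter 2∣ S = odd-length S (subst (2 ∣_) (length≡ S) 2∣)

  antipodes-sum : suc N ≡ h + h → ∀ {x₁ y₁ x₂ y₂} → A.d x₁ x₂ ≡ M → B.d y₁ y₂ ≡ h →
                  ∀ v → d (x₁ , y₁) v + d v (x₂ , y₂) ≡ M + h
  antipodes-sum even {x₁} {y₁} {x₂} {y₂} p q (x , y) = begin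
    (A.d x₁ x + B.d y₁ y) + (A.d x x₂ + B.d y y₂) ≡⟨ interchange +-commutativeSemigroup (A.d x₁ x) _ _ _ ⟩
    (A.d x₁ x + A.d x x₂) + (B.d y₁ y + B.d y y₂) ≡⟨ cong₂ _+_ (PF.antipodes {x₁} {x₂} p x) (CF.even-antipodes even q y) ⟩
    M + h                                         ∎
    where
    open ≡-Reasoning

  -- From minimal configurations to the upper bounds.

  search : {Q : V G → Set} → (∀ v → Dec (Q v)) → Dec (∃ Q)
  search Q? = map′ (λ (x , y , q) → (x , y) , q) (λ ((x , y) , q) → x , y , q)
    (any? λ x → any? λ y → Q? (x , y))

  -- Finite search stands in for excluded middle, so the upper bounds may argue by contradiction and
  -- still produce a 3-AP.
  rainbow? : ∀ {r} (c : V G → Fin r) → HasRainbow3AP G c ⊎ Colouring.RainbowFree d c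
  rainbow? c with search (λ u → search λ v → search λ w → (d u v ≟ d v w) ×-dec
    ¬? (c u F.≟ c v) ×-dec ¬? (c v F.≟ c w) ×-dec ¬? (c u F.≟ c w))
  ... | yes (u , v , w , eq , distinct) =
        inj₁ (u , v , w , d u v , dist u v , subst (Dist G v w) (sym eq) (dist v w) , distinct)
  ... | no none = inj₂ λ u v w eq p q s → none (u , v , w , eq , p , q , s)

  -- Two attained colours give a bichromatic edge, and `third` a colour missing from it. A vertex of
  -- that colour yields a configuration, which the descent on `k` refutes.
  no-separated⇒rainbow : ∀ {r} → (∀ (a b : Fin (2 + r)) → ∃ λ e → e ≢ a × e ≢ b) →
    (c : V G → Fin (2 + r)) → Surj c →
    (∀ k → Colouring.RainbowFree d c → Colouring.NoneBelow d c k → ∀ {ρ b w} → ¬ Colouring.Separated d c k ρ b w) →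
    HasRainbow3AP G c
  no-separated⇒rainbow {r} third c surj none with rainbow? c
  ... | inj₁ rainbow = rainbow
  ... | inj₂ free =
    let open Colouring d c
        u , cu = surj F.zero
        v , cv = surj (F.suc F.zero)
        b , t , bt , b≢t = bichromatic-edge isGeodesic _ refl (λ e → 0≢1 (trans (sym cu) (trans e cv)))
        e , e≢b , e≢t = third (c b) (c t)
        w , cw = surj e
    in ⊥-elim (no-minimal⇒none (λ k → none k free) (d t w) (record
         { t = t ; bt = bt ; tw = refl ; ct = refl ; b≢ρ = b≢t
         ; w≢ρ = λ x → e≢t (trans (sym cw) x) ; b≢w = λ x → e≢b (sym (trans x cw)) }))
    where
    0≢1 : F.zero ≢ F.suc {suc r} F.zero
    0≢1 ()

  third-colour : ∀ (a b : Fin 3) → ∃ λ e → e ≢ a × e ≢ b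
  third-colour = from-yes (all? {3} λ a → all? {3} λ b → any? {3} λ e → ¬? (e F.≟ a) ×-dec ¬? (e F.≟ b))

  fourth-colour : ∀ (a b c : Fin 4) → ∃ λ e → e ≢ a × e ≢ b × e ≢ c
  fourth-colour = from-yes (all? {4} λ a → all? {4} λ b → all? {4} λ c → any? {4} λ e →
    ¬? (e F.≟ a) ×-dec ¬? (e F.≟ b) ×-dec ¬? (e F.≟ c))

  three-colours : suc N ≡ suc (h + h) ⊎ 2 ∣ M + h → AWProp G 3
  three-colours hyp c surj = no-separated⇒rainbow third-colour c surj λ k free none-below →
    [ Antipodal.no-odd-cycle c free k none-below , Antipodal.no-even-diameter c free k none-below ]′ hyp

  four-colours : suc N ≡ h + h → AWProp G 4
  four-colours even c surj = no-separated⇒rainbow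
    (λ a b → let e , p , q , _ = fourth-colour a b a in e , p , q) c surj none
    where
    open Colouring d c
    none : ∀ k → RainbowFree → NoneBelow k → ∀ {ρ b w} → ¬ Separated k ρ b w
    none k free none-below {ρ} {b} {w} S =
      let open Antipodal c free k none-below
          p , q = antipodal S
          e , e≢ρ , e≢b , e≢w = fourth-colour ρ (c b) (c w)
          v , cv = surj e
      in Minimal.no-fourth-colour isGeodesic free k none-below S
           (trans (antipodes-sum even {proj₁ b} {proj₂ b} {proj₁ w} p q v) (length≡ S))
           (λ x → e≢ρ (trans (sym cv) x)) (λ x → e≢b (trans (sym cv) x)) (λ x → e≢w (trans (sym cv) x))

  -- The diameter and the lower bounds.

  start end : V G
  start = F.zero , CF.pt 0
  end   = fromℕ M , CF.pt h

  start-end-path : A.d F.zero (fromℕ M) ≡ M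
  start-end-path = toℕ-fromℕ M

  start-end-cycle : B.d (CF.pt 0) (CF.pt h) ≡ h
  start-end-cycle = CF.arcˡ h lower refl refl refl

  start-end : d start end ≡ M + h
  start-end = cong₂ _+_ start-end-path start-end-cycle

  start≢end : start ≢ end
  start≢end e = <⇒≢ (≤-trans 1≤M (m≤m+n M h))
    (trans (sym (d-refl start)) (trans (cong (d start) e) start-end))

  diameter : IsDiam G (M + h)
  diameter = (start , end , subst (Dist G start end) start-end (dist start end)) ,
    λ u v → d u v , dist u v , +-mono-≤ (PF.d≤M (proj₁ u) (proj₁ v)) (cycle≤h (proj₂ u) (proj₂ v))

  -- Used in both directions, this identifies any diameter given by hypothesis with `M + h`.
  diameter-≤ : ∀ {D D′} → IsDiam G D → IsDiam G D′ → D ≤ D′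
  diameter-≤ ((u , v , uv) , _) (_ , bound) = let k , uv′ , k≤D′ = bound u v in
    subst (_≤ _) (trans (dist-unique uv′) (sym (dist-unique uv))) k≤D′

  _≟ⱽ_ : DecidableEquality (V G)
  _≟ⱽ_ = ≡-dec F._≟_ F._≟_

  few-colours : ∀ {s} → s ≤ 2 → (c : V G → Fin s) → ¬ HasRainbow3AP G c
  few-colours {s} s≤2 c (u , v , w , _ , _ , _ , u≢v , v≢w , u≢w) =
    pigeon (c u) (c v) (c w) s≤2 u≢v v≢w u≢w
    where
    pigeon : ∀ {s} (i j l : Fin s) → s ≤ 2 → i ≢ j → j ≢ l → i ≢ l → ⊥
    pigeon F.zero F.zero l _ p q s = p refl
    pigeon F.zero (F.suc F.zero) F.zero _ p q s = s refl
    pigeon F.zero (F.suc F.zero) (F.suc F.zero) _ p q s = q refl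
    pigeon (F.suc F.zero) F.zero F.zero _ p q s = q refl
    pigeon (F.suc F.zero) F.zero (F.suc F.zero) _ p q s = s refl
    pigeon (F.suc F.zero) (F.suc F.zero) l _ p q s = p refl
    pigeon {suc (suc (suc _))} _ _ _ (s≤s (s≤s ()))

  not-one : ¬ AWProp G 1
  not-one aw = few-colours (s≤s z≤n) c (aw c λ { F.zero → start , refl })
    where
    c : V G → Fin 1
    c _ = F.zero

  not-two : ¬ AWProp G 2
  not-two aw = few-colours ≤-refl c (aw c surj)
    where
    c : V G → Fin 2
    c v = if does (v ≟ⱽ start) then F.zero else F.suc F.zero
    surj : Surj c
    surj F.zero = start , cong (λ p → if p then F.zero else F.suc F.zero) (dec-true (start ≟ⱽ start) refl)
    surj (F.suc F.zero) = end , cong (λ p → if p then F.zero else F.suc F.zero)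
      (dec-false (end ≟ⱽ start) (λ e → start≢end (sym e)))

  not-three : suc N ≡ h + h → ¬ (2 ∣ M + h) → ¬ AWProp G 3
  not-three even odd aw = rainbow-free (aw c surj)
    where
    -- The decisions are arguments so that the lemmas about `colour` can match on them directly.
    colour : ∀ {v} → Dec (v ≡ start) → Dec (v ≡ end) → Fin 3
    colour (yes _) _ = F.zero
    colour (no _) (yes _) = F.suc F.zero
    colour (no _) (no _) = F.suc (F.suc F.zero)

    c : V G → Fin 3
    c v = colour (v ≟ⱽ start) (v ≟ⱽ end)

    kind : ∀ v → v ≡ start ⊎ v ≡ end ⊎ c v ≡ F.suc (F.suc F.zero)
    kind v with v ≟ⱽ start | v ≟ⱽ end
    ... | yes p | _ = inj₁ p
    ... | no _ | yes p = inj₂ (inj₁ p)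
    ... | no _ | no _ = inj₂ (inj₂ refl)

    colour-start : ∀ {v} p q → v ≡ start → colour {v} p q ≡ F.zero
    colour-start (yes _) _ _ = refl
    colour-start (no ¬p) _ e = ⊥-elim (¬p e)

    colour-end : ∀ {v} p q → v ≡ end → colour {v} p q ≡ F.suc F.zero
    colour-end (yes p) _ e = ⊥-elim (start≢end (trans (sym p) e))
    colour-end (no _) (yes _) _ = refl
    colour-end (no _) (no ¬q) e = ⊥-elim (¬q e)

    colour-other : ∀ {v} p q → v ≢ start → v ≢ end → colour {v} p q ≡ F.suc (F.suc F.zero)
    colour-other (yes p) _ ¬p _ = ⊥-elim (¬p p)
    colour-other (no _) (yes q) _ ¬q = ⊥-elim (¬q q)
    colour-other (no _) (no _) _ _ = refl

    other : ∃ λ v → v ≢ start × v ≢ end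
    -- Since `M + h` is at least 2, the first vertex after `start` on a geodesic to `end` differs
    -- from both.
    other = let v , sv , _ = d-split 1 (pred (M + h)) {start} {end} (trans start-end (sym (suc-pred (M + h) {{>-nonZero (<⇒≤ 1<D)}}))) in
      v , (λ e → <⇒≢ (s≤s z≤n) (trans (sym (d-refl start)) (trans (cong (d start) (sym e)) sv))) ,
      (λ e → <⇒≢ 1<D (trans (sym sv) (trans (cong (d start) e) start-end)))
      where
      1<D : 1 < M + h
      1<D = +-mono-≤ 1≤M 1≤h

    surj : Surj c
    surj F.zero = start , colour-start (start ≟ⱽ start) (start ≟ⱽ end) refl
    surj (F.suc F.zero) = end , colour-end (end ≟ⱽ start) (end ≟ⱽ end) refl
    surj (F.suc (F.suc F.zero)) = let v , p , q = other in v , colour-other (v ≟ⱽ start) (v ≟ⱽ end) p q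

    -- The distances to `start` and `end` determine each other. Hence each of the two is the only
    -- vertex at full distance from the other, and a vertex equidistant from both would make `M + h`
    -- even.
    sum : ∀ v → d start v + d v end ≡ M + h
    sum = antipodes-sum even {F.zero} {CF.pt 0} {fromℕ M} start-end-path start-end-cycle

    only-end : ∀ v → d start v ≡ d start end → v ≡ end
    only-end v eq = d-zero (+-cancelˡ-≡ (d start v) _ 0
      (trans (sum v) (trans (sym start-end) (trans (sym eq) (sym (+-identityʳ (d start v)))))))

    only-start : ∀ v → d v end ≡ d start end → v ≡ start
    only-start v eq = sym (d-zero (+-cancelʳ-≡ (d v end) (d start v) 0 (trans (sum v) (trans (sym start-end) (sym eq)))))

    no-midpoint : ∀ v → d start v ≢ d v end
    no-midpoint v eq = odd (divides (d start v) (begin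
      M + h                 ≡⟨ sum v ⟨
      d start v + d v end   ≡⟨ cong (d start v +_) eq ⟨
      d start v + d start v ≡⟨ cong (d start v +_) (+-identityʳ (d start v)) ⟨
      2 * d start v         ≡⟨ *-comm 2 (d start v) ⟩
      d start v * 2         ∎))
      where open ≡-Reasoning

    no-isosceles : ∀ u v w → d u v ≡ d v w → c u ≢ c v → c v ≢ c w → c u ≢ c w → ⊥
    no-isosceles u v w eq u≢v v≢w u≢w with kind u | kind v | kind w
    ... | inj₁ refl        | inj₁ refl        | _                = u≢v refl
    ... | inj₁ refl        | _                | inj₁ refl        = u≢w refl
    ... | _                | inj₁ refl        | inj₁ refl        = v≢w refl
    ... | inj₂ (inj₁ refl) | inj₂ (inj₁ refl) | _                = u≢v refl
    ... | inj₂ (inj₁ refl) | _                | inj₂ (inj₁ refl) = u≢w refl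
    ... | _                | inj₂ (inj₁ refl) | inj₂ (inj₁ refl) = v≢w refl
    ... | inj₂ (inj₂ p)    | inj₂ (inj₂ q)    | _                = u≢v (trans p (sym q))
    ... | inj₂ (inj₂ p)    | _                | inj₂ (inj₂ q)    = u≢w (trans p (sym q))
    ... | _                | inj₂ (inj₂ p)    | inj₂ (inj₂ q)    = v≢w (trans p (sym q))
    -- Three different kinds remain. A middle vertex of the common colour contradicts parity; if the
    -- middle is `start` or `end`, the outer vertex of the common colour is forced to be the
    -- opposite corner.
    ... | inj₁ refl        | inj₂ (inj₂ _)    | inj₂ (inj₁ refl) = no-midpoint v eq
    ... | inj₂ (inj₁ refl) | inj₂ (inj₂ _)    | inj₁ refl        =
          no-midpoint v (trans (d-sym start v) (trans (sym eq) (d-sym end v)))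
    ... | inj₁ refl        | inj₂ (inj₁ refl) | inj₂ (inj₂ _)    =
          u≢w (cong c (sym (only-start w (trans (d-sym w end) (sym eq)))))
    ... | inj₂ (inj₂ _)    | inj₂ (inj₁ refl) | inj₁ refl        =
          u≢w (cong c (only-start u (trans eq (d-sym end start))))
    ... | inj₂ (inj₁ refl) | inj₁ refl        | inj₂ (inj₂ _)    =
          u≢w (cong c (sym (only-end w (trans (sym eq) (d-sym end start)))))
    ... | inj₂ (inj₂ _)    | inj₁ refl        | inj₂ (inj₁ refl) =
          u≢w (cong c (only-end u (trans (d-sym start u) eq)))

    rainbow-free : ¬ HasRainbow3AP G c
    rainbow-free (u , v , w , _ , uv , vw , distinct) = let u≢v , v≢w , u≢w = distinct in
      no-isosceles u v w (trans (sym (dist-unique uv)) (dist-unique vw)) u≢v v≢w u≢w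

-- Assembling the parity cases.

halve : ∀ n → ∃ λ h → n ≡ h + h ⊎ n ≡ suc (h + h)
halve zero = 0 , inj₁ refl
halve (suc n) with halve n
... | h , inj₁ e = h , inj₂ (cong suc e)
... | h , inj₂ e = suc h , inj₁ (cong suc (trans e (sym (+-suc h h))))

theorem5 : ∀ (m n : ℕ) → 2 ≤ m → 3 ≤ n →
    ((2 ∣ n × ∃ (λ D → IsDiam (P m □ C n) D × ¬ (2 ∣ D))) → AW3≡ (P m □ C n) 4)
    × (¬ (2 ∣ n × ∃ (λ D → IsDiam (P m □ C n) D × ¬ (2 ∣ D))) → AW3≡ (P m □ C n) 3)
theorem5 (suc M) (suc N) (s≤s 1≤M) (s≤s 2≤N) = four , three (halve (suc N))
  where
  G : Graph
  G = P (suc M) □ C (suc N)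

  four : 2 ∣ suc N × ∃ (λ D → IsDiam G D × ¬ (2 ∣ D)) → AW3≡ G 4
  four (divides h eq , D , diam , odd) = s≤s z≤n , Cy.four-colours even , below-four
    where
    even : suc N ≡ h + h
    even = trans eq (trans (*-comm h 2) (cong (h +_) (+-identityʳ h)))
    module Cy = Cylinder M N h 1≤M 2≤N (≤-reflexive (sym even)) (≤-trans (≤-reflexive even) (n≤1+n _))
    odd′ : ¬ (2 ∣ M + h)
    odd′ 2∣ = odd (subst (2 ∣_)
      (≤-antisym (Cy.diameter-≤ Cy.diameter diam) (Cy.diameter-≤ diam Cy.diameter)) 2∣)
    below-four : ∀ s → 1 ≤ s → s < 4 → ¬ AWProp G s
    below-four 1 _ _ = Cy.not-one
    below-four 2 _ _ = Cy.not-two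
    below-four 3 _ _ = Cy.not-three even odd′
    below-four (suc (suc (suc (suc _)))) _ (s≤s (s≤s (s≤s (s≤s ()))))

  three : (∃ λ h → suc N ≡ h + h ⊎ suc N ≡ suc (h + h)) →
          ¬ (2 ∣ suc N × ∃ (λ D → IsDiam G D × ¬ (2 ∣ D))) → AW3≡ G 3
  three (h , e) ¬odd = s≤s z≤n , Cy.three-colours (case e) , below-three
    where
    lower : h + h ≤ suc N
    lower = [ (λ x → ≤-reflexive (sym x)) , (λ x → ≤-trans (n≤1+n _) (≤-reflexive (sym x))) ]′ e
    upper : suc N ≤ suc (h + h)
    upper = [ (λ x → ≤-trans (≤-reflexive x) (n≤1+n _)) , ≤-reflexive ]′ e
    module Cy = Cylinder M N h 1≤M 2≤N lower upper
    case : suc N ≡ h + h ⊎ suc N ≡ suc (h + h) → suc N ≡ suc (h + h) ⊎ 2 ∣ M + h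
    case (inj₂ odd) = inj₁ odd
    -- Divisibility is decidable, so it suffices to refute an odd `M + h`, which for even `n` would
    -- meet the excluded condition.
    case (inj₁ even) = inj₂ (decidable-stable (2 ∣? (M + h)) λ odd →
      ¬odd (divides h (trans even (trans (cong (h +_) (sym (+-identityʳ h))) (*-comm 2 h))) , M + h , Cy.diameter , odd))
    below-three : ∀ s → 1 ≤ s → s < 3 → ¬ AWProp G s
    below-three 1 _ _ = Cy.not-one
    below-three 2 _ _ = Cy.not-two
    below-three (suc (suc (suc _))) _ (s≤s (s≤s (s≤s ())))
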